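{- Let $n\ge1$ and let $\mathbb{Q}\mathcal{Y}_n$ be the $\mathbb{Q}$-vector space with basis the set $\mathcal{Y}_n$ of Young diagrams with at most $n$ rows. The linear operators $\widehat D_-,\widehat D_0,\widehat D_+$ on $\mathbb{Q}\mathcal{Y}_n$ acting on $\lambda\in\mathcal{Y}_n$ by $$\widehat D_-(\lambda)=-\big(n\,\xi_-(\lambda)+\nabla_-(\lambda)\big),\qquad \widehat D_0(\lambda)=2|\lambda|\,\lambda,\qquad \widehat D_+(\lambda)=\nabla_+(\lambda)$$ define an $\mathfrak{sl}_2$-action on $\mathbb{Q}\mathcal{Y}_n$; that is, $[\widehat D_+,\widehat D_-]=\widehat D_0$, $[\widehat D_0,\widehat D_+]=2\widehat D_+$ and $[\widehat D_0,\widehat D_-]=-2\widehat D_-$.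
   Context: Young diagrams with at most $n$ rows are identified with partitions having at most $n$ nonzero parts; $|\lambda|$ is the number of cells of $\lambda$. The content of a cell $\square=(i,j)$ (row $i$, column $j$) is $c(\square)=j-i$. The linear operators $\xi_-,\nabla_\pm$ on $\mathbb{Q}\mathcal{Y}_n$ are defined on $\lambda\in\mathcal{Y}_n$ by $$\xi_-(\lambda)=\sum_{\mu=\lambda-\square\in\mathcal{Y}_n}\mu,\qquad \nabla_\pm(\lambda)=\sum_{\mu=\lambda\pm\square\in\mathcal{Y}_n}c(\square)\,\mu,$$ where the sums run over all $\mu\in\mathcal{Y}_n$ obtained from $\lambda$ by removing (for $-$) or adding (for $+$) exactly one cell $\square$. The Lie algebra $\mathfrak{sl}_2$ has basis $\mathfrak{e}_-,\mathfrak{h},\mathfrak{e}_+$ with $[\mathfrak{h},\mathfrak{e}_+]=2\mathfrak{e}_+$, $[\mathfrak{h},\mathfrak{e}_-]=-2\mathfrak{e}_-$, $[\mathfrak{e}_+,\mathfrak{e}_-]=\mathfrak{h}$, and $\mathfrak{e}_\pm\mapsto\widehat D_\pm$, $\mathfrak{h}\mapsto\widehat D_0$. -}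

module Defs where

open import Algebra.Bundles using (CommutativeMonoid; CommutativeRing)
open import Algebra.Module.Bundles using (Module)
open import Algebra.Module.Structures.Biased using (IsModuleFromLeft)
import Algebra.Module.Morphism.Construct.Composition as Composition
import Algebra.Module.Morphism.Structures as Morphisms
import Algebra.Properties.AbelianGroup as AbelianGroupProperties
import Algebra.Properties.CommutativeSemigroup as CommutativeSemigroupProperties
open import Data.Bool.Base using (if_then_else_)
open import Data.Fin.Base using (Fin; toℕ)
open import Data.Integer.Base as ℤ using (ℤ; +_)
open import Data.List.Base using (List; []; _∷_; _++_; map; mapMaybe; allFin; length)
open import Data.Maybe.Base as Maybe using (Maybe; nothing)
open import Data.Nat.Base as ℕ using (ℕ; zero; suc; _≥_; z≤n; s≤s)
import Data.Nat.Properties as ℕₚ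
open import Data.Product.Base using (_×_; _,_; map₁)
open import Data.Rational.Base using (ℚ; 0ℚ; 1ℚ; _/_; _+_; _*_; -_)
open import Data.Rational.Properties
open import Data.Vec.Base as Vec using (Vec; lookup; updateAt; _[_]≔_)
import Data.Vec.Properties as Vecₚ
import Data.Vec.Relation.Unary.Linked as Linked
open Linked using (Linked)
open import Level using (0ℓ; _⊔_)
open import Relation.Binary.Definitions using (DecidableEquality)
open import Relation.Binary.PropositionalEquality
open import Relation.Binary.Structures using (IsEquivalence)
open import Relation.Nullary.Decidable using (does; yes; no; map′; dec⇒maybe)
open import Relation.Nullary.Negation using (contradiction)
import Relation.Binary.Reasoning.Setoid as SetoidReasoning

module LinearOperators {r ℓr m ℓm} {R : CommutativeRing r ℓr} (M : Module R m ℓm) where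

  open CommutativeRing R using () renaming (Carrier to S; *-comm to S*-comm)
  open Module M
  open Morphisms.ModuleMorphisms rawModule rawModule using (IsModuleHomomorphism)
  open AbelianGroupProperties +ᴹ-abelianGroup using (⁻¹-∙-comm)
  open CommutativeSemigroupProperties
    (CommutativeMonoid.commutativeSemigroup +ᴹ-commutativeMonoid) using (interchange)
  open SetoidReasoning ≈ᴹ-setoid

  infixr 9 _⊙_
  infixr 8 _•_
  infixl 6 _⊖_
  infix 4 _≋_

  record LinearOperator : Set (r ⊔ m ⊔ ℓm) where
    infixr 9 _·_
    field
      _·_                  : Carrierᴹ → Carrierᴹ
      isModuleHomomorphism : IsModuleHomomorphism _·_
    open IsModuleHomomorphism isModuleHomomorphism public

  open LinearOperator public using (_·_)

  -- The right action of R agrees with the left one, so left homogeneity suffices.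
  linearOperator : (f : Carrierᴹ → Carrierᴹ) →
                   (∀ {u v} → u ≈ᴹ v → f u ≈ᴹ f v) →
                   (∀ u v → f (u +ᴹ v) ≈ᴹ f u +ᴹ f v) →
                   (∀ a u → f (a *ₗ u) ≈ᴹ a *ₗ f u) →
                   LinearOperator
  linearOperator f f-cong f-+ f-* = record
    { _·_ = f
    ; isModuleHomomorphism = record
      { isBimoduleHomomorphism = record
        { +ᴹ-isGroupHomomorphism = record
          { isMonoidHomomorphism = record
            { isMagmaHomomorphism = record
              { isRelHomomorphism = record { cong = f-cong }
              ; homo = f-+
              }
            ; ε-homo = f-0
            }
          ; ⁻¹-homo = f-neg
          }
        ; *ₗ-homo = f-*
        ; *ᵣ-homo = λ a u → ≈ᴹ-trans (f-cong (≈ᴹ-sym (*ₗ-*ᵣ-coincident a u)))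
                             (≈ᴹ-trans (f-* a u) (*ₗ-*ᵣ-coincident a (f u)))
        }
      }
    }
    where
    open CommutativeRing R using (0#)
    f-0 : f 0ᴹ ≈ᴹ 0ᴹ
    f-0 = begin
      f 0ᴹ          ≈⟨ f-cong (*ₗ-zeroˡ 0ᴹ) ⟨
      f (0# *ₗ 0ᴹ)  ≈⟨ f-* 0# 0ᴹ ⟩
      0# *ₗ f 0ᴹ    ≈⟨ *ₗ-zeroˡ (f 0ᴹ) ⟩
      0ᴹ            ∎
    f-neg : ∀ u → f (-ᴹ u) ≈ᴹ -ᴹ f u
    f-neg u = uniqueʳ‿-ᴹ (f u) (f (-ᴹ u)) (begin
      f u +ᴹ f (-ᴹ u)  ≈⟨ f-+ u (-ᴹ u) ⟨
      f (u +ᴹ -ᴹ u)    ≈⟨ f-cong (-ᴹ‿inverseʳ u) ⟩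
      f 0ᴹ             ≈⟨ f-0 ⟩
      0ᴹ               ∎)

  _≋_ : LinearOperator → LinearOperator → Set (m ⊔ ℓm)
  F ≋ G = ∀ v → F · v ≈ᴹ G · v

  _⊙_ : LinearOperator → LinearOperator → LinearOperator
  F ⊙ G = record
    { _·_ = λ v → F · G · v
    ; isModuleHomomorphism = Composition.isModuleHomomorphism ≈ᴹ-trans
        (LinearOperator.isModuleHomomorphism G) (LinearOperator.isModuleHomomorphism F)
    }

  _⊖_ : LinearOperator → LinearOperator → LinearOperator
  F ⊖ G = linearOperator (λ v → F · v +ᴹ -ᴹ (G · v))
    (λ u≈v → +ᴹ-cong (F.⟦⟧-cong u≈v) (-ᴹ‿cong (G.⟦⟧-cong u≈v)))
    (λ u v → begin
      F · (u +ᴹ v) +ᴹ -ᴹ (G · (u +ᴹ v))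
        ≈⟨ +ᴹ-cong (F.+ᴹ-homo u v) (-ᴹ‿cong (G.+ᴹ-homo u v)) ⟩
      (F · u +ᴹ F · v) +ᴹ -ᴹ (G · u +ᴹ G · v)
        ≈⟨ +ᴹ-cong ≈ᴹ-refl (⁻¹-∙-comm (G · u) (G · v)) ⟨
      (F · u +ᴹ F · v) +ᴹ (-ᴹ (G · u) +ᴹ -ᴹ (G · v))
        ≈⟨ interchange (F · u) (F · v) (-ᴹ (G · u)) (-ᴹ (G · v)) ⟩
      (F · u +ᴹ -ᴹ (G · u)) +ᴹ (F · v +ᴹ -ᴹ (G · v)) ∎)
    (λ a u → begin
      F · (a *ₗ u) +ᴹ -ᴹ (G · (a *ₗ u))
        ≈⟨ +ᴹ-cong (F.*ₗ-homo a u) (≈ᴹ-trans (≈ᴹ-sym (G.-ᴹ-homo (a *ₗ u)))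
             (≈ᴹ-trans (G.⟦⟧-cong (neg-* a u)) (≈ᴹ-trans (G.*ₗ-homo a (-ᴹ u))
             (*ₗ-congˡ (G.-ᴹ-homo u))))) ⟩
      a *ₗ (F · u) +ᴹ a *ₗ -ᴹ (G · u)
        ≈⟨ *ₗ-distribˡ a (F · u) (-ᴹ (G · u)) ⟨
      a *ₗ (F · u +ᴹ -ᴹ (G · u)) ∎)
    where
    module F = LinearOperator F
    module G = LinearOperator G
    neg-* : ∀ a u → -ᴹ (a *ₗ u) ≈ᴹ a *ₗ -ᴹ u
    neg-* a u = ≈ᴹ-sym (uniqueʳ‿-ᴹ (a *ₗ u) (a *ₗ -ᴹ u) (begin
      a *ₗ u +ᴹ a *ₗ -ᴹ u  ≈⟨ *ₗ-distribˡ a u (-ᴹ u) ⟨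
      a *ₗ (u +ᴹ -ᴹ u)     ≈⟨ *ₗ-congˡ (-ᴹ‿inverseʳ u) ⟩
      a *ₗ 0ᴹ              ≈⟨ *ₗ-zeroʳ a ⟩
      0ᴹ                   ∎))

  _•_ : S → LinearOperator → LinearOperator
  a • F = linearOperator (λ v → a *ₗ (F · v))
    (λ u≈v → *ₗ-congˡ (F.⟦⟧-cong u≈v))
    (λ u v → ≈ᴹ-trans (*ₗ-congˡ (F.+ᴹ-homo u v)) (*ₗ-distribˡ a (F · u) (F · v)))
    (λ b u → begin
      a *ₗ (F · (b *ₗ u))          ≈⟨ *ₗ-congˡ (F.*ₗ-homo b u) ⟩
      a *ₗ b *ₗ (F · u)            ≈⟨ *ₗ-assoc a b (F · u) ⟨
      (a CR.* b) *ₗ (F · u)        ≈⟨ *ₗ-congʳ (S*-comm a b) ⟩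
      (b CR.* a) *ₗ (F · u)        ≈⟨ *ₗ-assoc b a (F · u) ⟩
      b *ₗ a *ₗ (F · u)            ∎)
    where
    module F = LinearOperator F
    module CR = CommutativeRing R

  ⁅_,_⁆ : LinearOperator → LinearOperator → LinearOperator
  ⁅ F , G ⁆ = F ⊙ G ⊖ G ⊙ F

-- The ℚ-vector space with basis B: formal linear combinations, identified
-- when all their coefficients agree.
module FreeVectorSpace {B : Set} (_≟_ : DecidableEquality B) where

  FormalSum : Set
  FormalSum = List (ℚ × B)

  coeff : FormalSum → B → ℚ
  coeff []            b = 0ℚ
  coeff ((a , c) ∷ u) b = (if does (c ≟ b) then a else 0ℚ) + coeff u b

  infix 4 _≈_
  infixr 7 _*ₗ_
  infixr 8 -ᴹ_

  record _≈_ (u v : FormalSum) : Set where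
    constructor mk≈
    field coeff-≡ : ∀ b → coeff u b ≡ coeff v b
  open _≈_ public

  _*ₗ_ : ℚ → FormalSum → FormalSum
  a *ₗ u = map (map₁ (a *_)) u

  -ᴹ_ : FormalSum → FormalSum
  -ᴹ u = map (map₁ -_) u

  basis : B → FormalSum
  basis b = (1ℚ , b) ∷ []

  -- The linear functional taking the value g b at each basis vector b.
  ⟪_,_⟫ : (B → ℚ) → FormalSum → ℚ
  ⟪ g , [] ⟫          = 0ℚ
  ⟪ g , (a , c) ∷ u ⟫ = a * g c + ⟪ g , u ⟫

  private
    open CommutativeSemigroupProperties
      (CommutativeMonoid.commutativeSemigroup +-0-commutativeMonoid)
      using () renaming (x∙yz≈y∙xz to +-swap)
    open ≡-Reasoning

    ⟪⟫-++ : ∀ g u v → ⟪ g , u ++ v ⟫ ≡ ⟪ g , u ⟫ + ⟪ g , v ⟫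
    ⟪⟫-++ g []            v = sym (+-identityˡ _)
    ⟪⟫-++ g ((a , c) ∷ u) v =
      trans (cong (_+_ (a * g c)) (⟪⟫-++ g u v)) (sym (+-assoc (a * g c) _ _))

    ⟪⟫-*ₗ : ∀ g a u → ⟪ g , a *ₗ u ⟫ ≡ a * ⟪ g , u ⟫
    ⟪⟫-*ₗ g a []            = sym (*-zeroʳ a)
    ⟪⟫-*ₗ g a ((b , c) ∷ u) =
      trans (cong₂ _+_ (*-assoc a b (g c)) (⟪⟫-*ₗ g a u)) (sym (*-distribˡ-+ a _ _))

    ⟪⟫-neg : ∀ g u → ⟪ g , -ᴹ u ⟫ ≡ - ⟪ g , u ⟫
    ⟪⟫-neg g []            = refl
    ⟪⟫-neg g ((b , c) ∷ u) =
      trans (cong₂ _+_ (sym (neg-distribˡ-* b (g c))) (⟪⟫-neg g u))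
            (sym (neg-distrib-+ (b * g c) _))

    indicator : B → B → ℚ
    indicator b c = if does (c ≟ b) then 1ℚ else 0ℚ

    coeff-⟪⟫ : ∀ u b → coeff u b ≡ ⟪ indicator b , u ⟫
    coeff-⟪⟫ []            b = refl
    coeff-⟪⟫ ((a , c) ∷ u) b with c ≟ b
    ... | yes _ = cong₂ _+_ (sym (*-identityʳ a)) (coeff-⟪⟫ u b)
    ... | no  _ = cong₂ _+_ (sym (*-zeroʳ a)) (coeff-⟪⟫ u b)

  coeff-++ : ∀ u v b → coeff (u ++ v) b ≡ coeff u b + coeff v b
  coeff-++ u v b rewrite coeff-⟪⟫ (u ++ v) b | coeff-⟪⟫ u b | coeff-⟪⟫ v b =
    ⟪⟫-++ (indicator b) u v

  coeff-*ₗ : ∀ a u b → coeff (a *ₗ u) b ≡ a * coeff u b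
  coeff-*ₗ a u b rewrite coeff-⟪⟫ (a *ₗ u) b | coeff-⟪⟫ u b = ⟪⟫-*ₗ (indicator b) a u

  coeff-neg : ∀ u b → coeff (-ᴹ u) b ≡ - coeff u b
  coeff-neg u b rewrite coeff-⟪⟫ (-ᴹ u) b | coeff-⟪⟫ u b = ⟪⟫-neg (indicator b) u

  private
    delete : B → FormalSum → FormalSum
    delete b [] = []
    delete b ((a , c) ∷ u) with c ≟ b
    ... | yes _ = delete b u
    ... | no  _ = (a , c) ∷ delete b u

    length-delete : ∀ b u → length (delete b u) ℕ.≤ length u
    length-delete b [] = z≤n
    length-delete b ((a , c) ∷ u) with c ≟ b
    ... | yes _ = ℕₚ.m≤n⇒m≤1+n (length-delete b u)
    ... | no  _ = s≤s (length-delete b u)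

    ⟪⟫-delete : ∀ g b u → ⟪ g , u ⟫ ≡ coeff u b * g b + ⟪ g , delete b u ⟫
    ⟪⟫-delete g b [] = sym (trans (+-identityʳ _) (*-zeroˡ (g b)))
    ⟪⟫-delete g b ((a , c) ∷ u) with c ≟ b
    ... | yes refl = begin
      a * g c + ⟪ g , u ⟫                                ≡⟨ cong (_+_ (a * g c)) (⟪⟫-delete g c u) ⟩
      a * g c + (coeff u c * g c + ⟪ g , delete c u ⟫)   ≡⟨ +-assoc (a * g c) _ _ ⟨
      a * g c + coeff u c * g c + ⟪ g , delete c u ⟫     ≡⟨ cong (_+ ⟪ g , delete c u ⟫) (*-distribʳ-+ (g c) a (coeff u c)) ⟨
      (a + coeff u c) * g c + ⟪ g , delete c u ⟫         ∎
    ... | no _ = begin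
      a * g c + ⟪ g , u ⟫                                      ≡⟨ cong (_+_ (a * g c)) (⟪⟫-delete g b u) ⟩
      a * g c + (coeff u b * g b + ⟪ g , delete b u ⟫)         ≡⟨ +-swap (a * g c) (coeff u b * g b) _ ⟩
      coeff u b * g b + (a * g c + ⟪ g , delete b u ⟫)         ≡⟨ cong (λ x → x * g b + (a * g c + ⟪ g , delete b u ⟫)) (+-identityˡ (coeff u b)) ⟨
      (0ℚ + coeff u b) * g b + (a * g c + ⟪ g , delete b u ⟫)  ∎

    coeff-delete-≢ : ∀ b u d → b ≢ d → coeff (delete b u) d ≡ coeff u d
    coeff-delete-≢ b [] d b≢d = refl
    coeff-delete-≢ b ((a , c) ∷ u) d b≢d with c ≟ b
    ... | no _ = cong (_+_ (if does (c ≟ d) then a else 0ℚ)) (coeff-delete-≢ b u d b≢d)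
    ... | yes refl with c ≟ d
    ...   | yes c≡d = contradiction c≡d b≢d
    ...   | no _ = trans (coeff-delete-≢ b u d b≢d) (sym (+-identityˡ _))

    coeff-delete-≡ : ∀ b u → coeff (delete b u) b ≡ 0ℚ
    coeff-delete-≡ b [] = refl
    coeff-delete-≡ b ((a , c) ∷ u) with c ≟ b
    ... | yes _ = coeff-delete-≡ b u
    ... | no c≢b with c ≟ b
    ...   | yes c≡b = contradiction c≡b c≢b
    ...   | no _ = trans (+-identityˡ _) (coeff-delete-≡ b u)

    ⟪⟫-null : ∀ g k u → length u ℕ.≤ k → (∀ b → coeff u b ≡ 0ℚ) → ⟪ g , u ⟫ ≡ 0ℚ
    ⟪⟫-null g k       []              _         u≈0 = refl
    ⟪⟫-null g (suc k) u@((a , c) ∷ w) (s≤s w≤k) u≈0 = begin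
      ⟪ g , u ⟫                            ≡⟨ ⟪⟫-delete g c u ⟩
      coeff u c * g c + ⟪ g , delete c u ⟫ ≡⟨ cong₂ (λ x y → x * g c + y) (u≈0 c)
                                               (⟪⟫-null g k (delete c u) shorter null) ⟩
      0ℚ * g c + 0ℚ                        ≡⟨ trans (+-identityʳ _) (*-zeroˡ (g c)) ⟩
      0ℚ                                   ∎
      where
      shorter : length (delete c u) ℕ.≤ k
      shorter with c ≟ c
      ... | yes _  = ℕₚ.≤-trans (length-delete c w) w≤k
      ... | no c≢c = contradiction refl c≢c
      null : ∀ b → coeff (delete c u) b ≡ 0ℚ
      null b with c ≟ b
      ... | yes refl = coeff-delete-≡ c u
      ... | no c≢b   = trans (coeff-delete-≢ c u b c≢b) (u≈0 b)

  ⟪⟫-cong : ∀ g {u v} → u ≈ v → ⟪ g , u ⟫ ≡ ⟪ g , v ⟫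
  ⟪⟫-cong g {u} {v} u≈v = begin
    ⟪ g , u ⟫                               ≡⟨ +-identityʳ _ ⟨
    ⟪ g , u ⟫ + 0ℚ                          ≡⟨ cong (_+_ ⟪ g , u ⟫) (+-inverseˡ ⟪ g , v ⟫) ⟨
    ⟪ g , u ⟫ + (- ⟪ g , v ⟫ + ⟪ g , v ⟫)   ≡⟨ +-assoc ⟪ g , u ⟫ _ _ ⟨
    ⟪ g , u ⟫ + - ⟪ g , v ⟫ + ⟪ g , v ⟫     ≡⟨ cong (_+ ⟪ g , v ⟫) difference ⟩
    0ℚ + ⟪ g , v ⟫                          ≡⟨ +-identityˡ _ ⟩
    ⟪ g , v ⟫                               ∎
    where
    null : ∀ b → coeff (u ++ -ᴹ v) b ≡ 0ℚ
    null b = trans (coeff-++ u (-ᴹ v) b)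
      (trans (cong₂ _+_ (coeff-≡ u≈v b) (coeff-neg v b)) (+-inverseʳ (coeff v b)))
    difference : ⟪ g , u ⟫ + - ⟪ g , v ⟫ ≡ 0ℚ
    difference = trans (sym (trans (⟪⟫-++ g u (-ᴹ v)) (cong (_+_ ⟪ g , u ⟫) (⟪⟫-neg g v))))
      (⟪⟫-null g _ (u ++ -ᴹ v) ℕₚ.≤-refl null)

  private
    ≈-isEquivalence : IsEquivalence _≈_
    ≈-isEquivalence = record
      { refl  = mk≈ λ _ → refl
      ; sym   = λ p → mk≈ λ b → sym (coeff-≡ p b)
      ; trans = λ p q → mk≈ λ b → trans (coeff-≡ p b) (coeff-≡ q b)
      }

    coeff-+-cong : ∀ {u u′ v v′} → u ≈ u′ → v ≈ v′ → u ++ v ≈ u′ ++ v′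
    coeff-+-cong {u} {u′} {v} {v′} p q = mk≈ λ b →
      trans (coeff-++ u v b)
        (trans (cong₂ _+_ (coeff-≡ p b) (coeff-≡ q b)) (sym (coeff-++ u′ v′ b)))

    ++-comm : ∀ u v → u ++ v ≈ v ++ u
    ++-comm u v = mk≈ λ b → trans (coeff-++ u v b)
      (trans (+-comm (coeff u b) (coeff v b)) (sym (coeff-++ v u b)))

    ++-assoc : ∀ u v w → (u ++ v) ++ w ≈ u ++ (v ++ w)
    ++-assoc u v w = mk≈ λ b → begin
      coeff ((u ++ v) ++ w) b                ≡⟨ coeff-++ (u ++ v) w b ⟩
      coeff (u ++ v) b + coeff w b           ≡⟨ cong (_+ coeff w b) (coeff-++ u v b) ⟩
      coeff u b + coeff v b + coeff w b      ≡⟨ +-assoc (coeff u b) _ _ ⟩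
      coeff u b + (coeff v b + coeff w b)    ≡⟨ cong (_+_ (coeff u b)) (coeff-++ v w b) ⟨
      coeff u b + coeff (v ++ w) b           ≡⟨ coeff-++ u (v ++ w) b ⟨
      coeff (u ++ (v ++ w)) b                ∎

    ++-identityʳ : ∀ u → u ++ [] ≈ u
    ++-identityʳ u = mk≈ λ b → trans (coeff-++ u [] b) (+-identityʳ _)

    neg-inverseʳ : ∀ u → u ++ -ᴹ u ≈ []
    neg-inverseʳ u = mk≈ λ b → trans (coeff-++ u (-ᴹ u) b)
      (trans (cong (_+_ (coeff u b)) (coeff-neg u b)) (+-inverseʳ (coeff u b)))

    neg-inverseˡ : ∀ u → -ᴹ u ++ u ≈ []
    neg-inverseˡ u = IsEquivalence.trans ≈-isEquivalence (++-comm (-ᴹ u) u) (neg-inverseʳ u)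

  vectorSpace : Module +-*-commutativeRing 0ℓ 0ℓ
  vectorSpace = record
    { Carrierᴹ = FormalSum
    ; _≈ᴹ_     = _≈_
    ; _+ᴹ_     = _++_
    ; _*ₗ_     = _*ₗ_
    ; _*ᵣ_     = λ u a → a *ₗ u
    ; 0ᴹ       = []
    ; -ᴹ_      = -ᴹ_
    ; isModule = IsModuleFromLeft.isModule {commutativeRing = +-*-commutativeRing} record
      { isLeftModule = record
        { isLeftSemimodule = record
          { +ᴹ-isCommutativeMonoid = record
            { isMonoid = record
              { isSemigroup = record
                { isMagma = record
                  { isEquivalence = ≈-isEquivalence
                  ; ∙-cong        = coeff-+-cong
                  }
                ; assoc = ++-assoc
                }
              ; identity = (λ _ → mk≈ λ _ → refl) , ++-identityʳ
              }
            ; comm = ++-comm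
            }
          ; isPreleftSemimodule = record
            { *ₗ-cong      = λ { {a} {_} {u} {v} refl p → mk≈ λ b →
                trans (coeff-*ₗ a u b)
                  (trans (cong (a *_) (coeff-≡ p b)) (sym (coeff-*ₗ a v b))) }
            ; *ₗ-zeroˡ     = λ u → mk≈ λ b → trans (coeff-*ₗ 0ℚ u b) (*-zeroˡ (coeff u b))
            ; *ₗ-distribʳ  = λ u a c → mk≈ λ b → begin
                coeff ((a + c) *ₗ u) b                ≡⟨ coeff-*ₗ (a + c) u b ⟩
                (a + c) * coeff u b                   ≡⟨ *-distribʳ-+ (coeff u b) a c ⟩
                a * coeff u b + c * coeff u b         ≡⟨ cong₂ _+_ (coeff-*ₗ a u b) (coeff-*ₗ c u b) ⟨
                coeff (a *ₗ u) b + coeff (c *ₗ u) b   ≡⟨ coeff-++ (a *ₗ u) (c *ₗ u) b ⟨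
                coeff (a *ₗ u ++ c *ₗ u) b            ∎
            ; *ₗ-identityˡ = λ u → mk≈ λ b → trans (coeff-*ₗ 1ℚ u b) (*-identityˡ (coeff u b))
            ; *ₗ-assoc     = λ a c u → mk≈ λ b → begin
                coeff ((a * c) *ₗ u) b   ≡⟨ coeff-*ₗ (a * c) u b ⟩
                a * c * coeff u b        ≡⟨ *-assoc a c (coeff u b) ⟩
                a * (c * coeff u b)      ≡⟨ cong (a *_) (coeff-*ₗ c u b) ⟨
                a * coeff (c *ₗ u) b     ≡⟨ coeff-*ₗ a (c *ₗ u) b ⟨
                coeff (a *ₗ c *ₗ u) b    ∎
            ; *ₗ-zeroʳ     = λ _ → mk≈ λ _ → refl
            ; *ₗ-distribˡ  = λ a u v → mk≈ λ b → begin
                coeff (a *ₗ (u ++ v)) b               ≡⟨ coeff-*ₗ a (u ++ v) b ⟩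
                a * coeff (u ++ v) b                  ≡⟨ cong (a *_) (coeff-++ u v b) ⟩
                a * (coeff u b + coeff v b)           ≡⟨ *-distribˡ-+ a (coeff u b) (coeff v b) ⟩
                a * coeff u b + a * coeff v b         ≡⟨ cong₂ _+_ (coeff-*ₗ a u b) (coeff-*ₗ a v b) ⟨
                coeff (a *ₗ u) b + coeff (a *ₗ v) b   ≡⟨ coeff-++ (a *ₗ u) (a *ₗ v) b ⟨
                coeff (a *ₗ u ++ a *ₗ v) b            ∎
            }
          }
        ; -ᴹ‿cong    = λ {u} {v} p → mk≈ λ b → trans (coeff-neg u b)
            (trans (cong -_ (coeff-≡ p b)) (sym (coeff-neg v b)))
        ; -ᴹ‿inverse = neg-inverseˡ , neg-inverseʳ
        }
      }
    }

  open LinearOperators vectorSpace using (LinearOperator; linearOperator; _·_)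

  private
    apply : (B → FormalSum) → FormalSum → FormalSum
    apply f []            = []
    apply f ((a , b) ∷ u) = a *ₗ f b ++ apply f u

    coeff-apply : ∀ f u b → coeff (apply f u) b ≡ ⟪ (λ c → coeff (f c) b) , u ⟫
    coeff-apply f []            b = refl
    coeff-apply f ((a , c) ∷ u) b = trans (coeff-++ (a *ₗ f c) (apply f u) b)
      (cong₂ _+_ (coeff-*ₗ a (f c) b) (coeff-apply f u b))

  extend : (B → FormalSum) → LinearOperator
  extend f = linearOperator (apply f)
    (λ {u} {v} p → mk≈ λ b → trans (coeff-apply f u b)
      (trans (⟪⟫-cong _ p) (sym (coeff-apply f v b))))
    (λ u v → mk≈ λ b → begin
      coeff (apply f (u ++ v)) b                     ≡⟨ coeff-apply f (u ++ v) b ⟩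
      ⟪ _ , u ++ v ⟫                                 ≡⟨ ⟪⟫-++ _ u v ⟩
      ⟪ _ , u ⟫ + ⟪ _ , v ⟫                          ≡⟨ cong₂ _+_ (coeff-apply f u b) (coeff-apply f v b) ⟨
      coeff (apply f u) b + coeff (apply f v) b      ≡⟨ coeff-++ (apply f u) (apply f v) b ⟨
      coeff (apply f u ++ apply f v) b               ∎)
    (λ a u → mk≈ λ b → begin
      coeff (apply f (a *ₗ u)) b     ≡⟨ coeff-apply f (a *ₗ u) b ⟩
      ⟪ _ , a *ₗ u ⟫                 ≡⟨ ⟪⟫-*ₗ _ a u ⟩
      a * ⟪ _ , u ⟫                  ≡⟨ cong (a *_) (coeff-apply f u b) ⟨
      a * coeff (apply f u) b        ≡⟨ coeff-*ₗ a (apply f u) b ⟨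
      coeff (a *ₗ apply f u) b       ∎)

  coeff-extend : ∀ f u b → coeff (extend f · u) b ≡ ⟪ (λ c → coeff (f c) b) , u ⟫
  coeff-extend = coeff-apply

  extend-basis : ∀ f b → extend f · basis b ≈ f b
  extend-basis f b = mk≈ λ c → trans (coeff-extend f (basis b) c)
    (trans (+-identityʳ _) (*-identityˡ (coeff (f b) c)))

record YoungDiagram (n : ℕ) : Set where
  constructor mkYD
  field
    rows       : Vec ℕ n
    decreasing : Linked _≥_ rows
open YoungDiagram public

rows-injective : ∀ {n} {l m : YoungDiagram n} → rows l ≡ rows m → l ≡ m
rows-injective {l = mkYD r p} {mkYD .r q} refl =
  cong (mkYD r) (Linked.irrelevant ℕₚ.≤-irrelevant p q)

_≟ʸ_ : ∀ {n} → DecidableEquality (YoungDiagram n)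
l ≟ʸ m = map′ rows-injective (cong rows) (Vecₚ.≡-dec ℕₚ._≟_ (rows l) (rows m))

∣_∣ : ∀ {n} → YoungDiagram n → ℕ
∣ l ∣ = Vec.sum (rows l)

-- Cells (row , column) are numbered from 0, which leaves the content unchanged.
Cell : Set
Cell = ℕ × ℕ

content : Cell → ℤ
content (i , j) = + j ℤ.- + i

youngDiagram? : ∀ {n} → Vec ℕ n → Maybe (YoungDiagram n)
youngDiagram? r = Maybe.map (mkYD r) (dec⇒maybe (Linked.linked? ℕₚ._≥?_ r))

addCell : ∀ {n} → YoungDiagram n → Fin n → Maybe (Cell × YoungDiagram n)
addCell l i = Maybe.map ((toℕ i , lookup (rows l) i) ,_)
  (youngDiagram? (updateAt (rows l) i suc))

removeCell : ∀ {n} → YoungDiagram n → Fin n → Maybe (Cell × YoungDiagram n)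
removeCell l i with lookup (rows l) i
... | zero  = nothing
... | suc j = Maybe.map ((toℕ i , j) ,_) (youngDiagram? (rows l [ i ]≔ j))

-- All pairs (□ , μ) with μ = l + □, respectively μ = l - □.
additions removals : ∀ {n} → YoungDiagram n → List (Cell × YoungDiagram n)
additions {n} l = mapMaybe (addCell l) (allFin n)
removals  {n} l = mapMaybe (removeCell l) (allFin n)

ℚ𝒴 : ℕ → Module +-*-commutativeRing 0ℓ 0ℓ
ℚ𝒴 n = FreeVectorSpace.vectorSpace (_≟ʸ_ {n})

module _ {n : ℕ} where
  open FreeVectorSpace (_≟ʸ_ {n}) public using (basis; extend)
  open LinearOperators (ℚ𝒴 n) public

module _ (n : ℕ) where
  open Module (ℚ𝒴 n) using (_+ᴹ_; _*ₗ_; -ᴹ_)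

  ξ₋ ∇₋ ∇₊ : LinearOperator {n}
  ξ₋ = extend {n} λ l → map (λ (_ , μ) → 1ℚ , μ) (removals l)
  ∇₋ = extend {n} λ l → map (λ (□ , μ) → content □ / 1 , μ) (removals l)
  ∇₊ = extend {n} λ l → map (λ (□ , μ) → content □ / 1 , μ) (additions l)

  D̂₋ D̂₀ D̂₊ : LinearOperator {n}
  D̂₋ = extend {n} λ l → -ᴹ ((+ n / 1) *ₗ (ξ₋ · basis l) +ᴹ ∇₋ · basis l)
  D̂₀ = extend {n} λ l → (+ (2 ℕ.* ∣ l ∣) / 1) *ₗ basis l
  D̂₊ = extend {n} λ l → ∇₊ · basis l

{-# OPTIONS --safe #-}

-- Each operator is replaced by its transpose, acting on functionals of the row
-- vector of a diagram. In [D̂₊ , D̂₋] the terms moving a cell from row i to row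
-- k ≠ i cancel: both orders carry the same weight, and both intermediate shapes
-- are diagrams as soon as the final one is. What remains is diagonal,
--   Σ c (n + c) over addable cells  -  Σ c (n + c) over removable cells,
-- where c is the content. An impossible addition to row i + 1 and the matching
-- impossible removal from row i have the same c, and removal from an empty last row
-- has n + c = 0, so all rows may be included in both sums: row i of length x then
-- contributes φ(x - i) - φ(x - i - 1) with φ(c) = c (n + c), in total 2 |λ|.
module Submission where

open import Defs using (module FreeVectorSpace; module LinearOperators)
open import Algebra.Bundles using (CommutativeRing)
import Algebra.Properties.Semiring.Sum as Sum
open import Data.Bool.Base using (true; false; if_then_else_)
open import Data.Fin.Base as Fin using (Fin; zero; suc; toℕ)
import Data.Fin.Properties as Finₚ
open import Data.Integer.Base as ℤ using (+_)
import Data.Integer.Properties as ℤₚ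
open import Data.List.Base using (List; []; _∷_; _++_; map; mapMaybe; tabulate)
open import Data.Maybe.Base using (Maybe; just; nothing; maybe)
open import Data.Nat.Base as ℕ using (ℕ; zero; suc; pred; _≤_; _<_; _≥_; _⊓_; _⊔_; s≤s; z≤n)
import Data.Nat.Properties as ℕₚ
open import Data.Product.Base using (_×_; _,_; proj₁; proj₂)
open import Data.Rational.Base using (ℚ; 0ℚ; 1ℚ; _/_; -_; _+_; _*_; _-_; toℚᵘ)
open import Data.Rational.Properties
open import Data.Rational.Solver using (module +-*-Solver)
import Data.Rational.Unnormalised.Base as ℚᵘ
import Data.Rational.Unnormalised.Properties as ℚᵘₚ
open import Data.Vec.Base as Vec using (Vec; []; _∷_; lookup; updateAt; zipWith; _[_]≔_)
import Data.Vec.Properties as Vecₚ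
open Vecₚ
  using (lookup∘updateAt; lookup∘updateAt′; updateAt-commutes; updateAt-cong-local;
         updateAt-updateAt-local; updateAt-id; updateAt-updateAt; zipWith-idem)
open import Data.Vec.Relation.Unary.Linked as Linked using (Linked; []; [-]; _∷_)
open import Function.Base using (_∘_; id)
open import Function.Bundles using (mk⇔)
open import Relation.Binary.Definitions using (DecidableEquality)
open import Relation.Binary.PropositionalEquality
import Relation.Binary.Reasoning.Setoid as SetoidReasoning
open import Relation.Nullary.Decidable
  using (Dec; does; yes; no; _×-dec_; does-⇔; dec-true; dec-false)
open import Relation.Nullary.Negation using (¬_; contradiction)

-- `_/_` divides by a gcd and is stuck on variables; among unnormalised fractions with denominator 1
-- the sum is immediate up to factors 1.
/1-homo-+ : ∀ i j → (i ℤ.+ j) / 1 ≡ i / 1 + j / 1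
/1-homo-+ i j = toℚᵘ-injective (begin
  toℚᵘ ((i ℤ.+ j) / 1)              ≈⟨ toℚᵘ-fromℚᵘ (ℚᵘ.mkℚᵘ (i ℤ.+ j) 0) ⟩
  ℚᵘ.mkℚᵘ (i ℤ.+ j) 0               ≡⟨ cong (λ k → ℚᵘ.mkℚᵘ k 0) (cong₂ ℤ._+_ (ℤₚ.*-identityʳ i) (ℤₚ.*-identityʳ j)) ⟨
  ℚᵘ.mkℚᵘ i 0 ℚᵘ.+ ℚᵘ.mkℚᵘ j 0      ≈⟨ ℚᵘₚ.+-cong (toℚᵘ-fromℚᵘ (ℚᵘ.mkℚᵘ i 0)) (toℚᵘ-fromℚᵘ (ℚᵘ.mkℚᵘ j 0)) ⟨
  toℚᵘ (i / 1) ℚᵘ.+ toℚᵘ (j / 1)    ≈⟨ toℚᵘ-homo-+ (i / 1) (j / 1) ⟨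
  toℚᵘ (i / 1 + j / 1)              ∎)
  where open SetoidReasoning ℚᵘₚ.≃-setoid

open ≡-Reasoning
open +-*-Solver using (solve; _:=_; _:+_; _:*_; :-_; _:-_; con)
open Sum (CommutativeRing.semiring +-*-commutativeRing)
  using (sum; sum-cong-≗; sum-remove; sum-replicate-zero; ∑-distrib-+; ∑-comm; *-distribˡ-sum; *-distribʳ-sum)

-- Functionals on a free vector space.

module _ {B : Set} (_≟_ : DecidableEquality B) where
  open FreeVectorSpace _≟_
  open LinearOperators vectorSpace

  pairing-++ : ∀ g u v → ⟪ g , u ++ v ⟫ ≡ ⟪ g , u ⟫ + ⟪ g , v ⟫
  pairing-++ g []            v = sym (+-identityˡ _)
  pairing-++ g ((a , b) ∷ u) v =
    trans (cong (_+_ (a * g b)) (pairing-++ g u v)) (sym (+-assoc (a * g b) _ _))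

  pairing-*ₗ : ∀ g a u → ⟪ g , a *ₗ u ⟫ ≡ a * ⟪ g , u ⟫
  pairing-*ₗ g a []            = sym (*-zeroʳ a)
  pairing-*ₗ g a ((b , c) ∷ u) = trans (cong (_+_ (a * b * g c)) (pairing-*ₗ g a u))
    (solve 4 (λ a b x y → a :* b :* x :+ a :* y := a :* (b :* x :+ y)) refl a b (g c) ⟪ g , u ⟫)

  pairing-neg : ∀ g u → ⟪ g , -ᴹ u ⟫ ≡ - ⟪ g , u ⟫
  pairing-neg g []            = refl
  pairing-neg g ((a , b) ∷ u) = trans (cong (_+_ (- a * g b)) (pairing-neg g u))
    (solve 3 (λ a x y → (:- a) :* x :+ (:- y) := :- (a :* x :+ y)) refl a (g b) ⟪ g , u ⟫)

  pairing-basis : ∀ g b → ⟪ g , basis b ⟫ ≡ g b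
  pairing-basis g b = trans (+-identityʳ _) (*-identityˡ (g b))

  pairing-congˡ : ∀ {f g} → (∀ b → f b ≡ g b) → ∀ u → ⟪ f , u ⟫ ≡ ⟪ g , u ⟫
  pairing-congˡ f≗g []            = refl
  pairing-congˡ f≗g ((a , b) ∷ u) = cong₂ (λ x y → a * x + y) (f≗g b) (pairing-congˡ f≗g u)

  coeff-pairing : ∀ u b → coeff u b ≡ ⟪ (λ c → coeff (basis c) b) , u ⟫
  coeff-pairing []            b = refl
  coeff-pairing ((a , c) ∷ u) b = cong₂ _+_ head-coeff (coeff-pairing u b)
    where
    head-coeff : (if does (c ≟ b) then a else 0ℚ) ≡ a * coeff (basis c) b
    head-coeff with does (c ≟ b)
    ... | true  = sym (*-identityʳ a)
    ... | false = sym (*-zeroʳ a)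

  -- This is the transpose of `F` applied to `g`. Linearity of `F` holds only up to `_≈_`, so each
  -- use of it passes through `⟪⟫-cong`.
  pairing-· : ∀ F g u → ⟪ g , F · u ⟫ ≡ ⟪ (λ b → ⟪ g , F · basis b ⟫) , u ⟫
  pairing-· F g []            = ⟪⟫-cong g (LinearOperator.0ᴹ-homo F)
  pairing-· F g ((a , b) ∷ u) = begin
    ⟪ g , F · ((a , b) ∷ u) ⟫
      -- The list `a *ₗ basis b ++ u` has head `(a * 1ℚ , b)`.
      ≡⟨ cong (λ x → ⟪ g , F · ((x , b) ∷ u) ⟫) (*-identityʳ a) ⟨
    ⟪ g , F · (a *ₗ basis b ++ u) ⟫
      ≡⟨ ⟪⟫-cong g (LinearOperator.+ᴹ-homo F (a *ₗ basis b) u) ⟩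
    ⟪ g , F · (a *ₗ basis b) ++ F · u ⟫
      ≡⟨ pairing-++ g (F · (a *ₗ basis b)) (F · u) ⟩
    ⟪ g , F · (a *ₗ basis b) ⟫ + ⟪ g , F · u ⟫
      ≡⟨ cong₂ _+_ (trans (⟪⟫-cong g (LinearOperator.*ₗ-homo F a (basis b)))
                          (pairing-*ₗ g a (F · basis b)))
                   (pairing-· F g u) ⟩
    a * ⟪ g , F · basis b ⟫ + ⟪ (λ b → ⟪ g , F · basis b ⟫) , u ⟫
      ∎

  -- Taking the coefficient at `c` is a functional, and by `pairing-·` its value at `F · v` depends
  -- only on the images `F · basis b`.
  ≋-on-basis : ∀ F G → (∀ c b → coeff (F · basis b) c ≡ coeff (G · basis b) c) → F ≋ G
  ≋-on-basis F G F≈G v = mk≈ λ c → begin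
    coeff (F · v) c                                  ≡⟨ coeff-pairing (F · v) c ⟩
    ⟪ δ c , F · v ⟫                                  ≡⟨ pairing-· F (δ c) v ⟩
    ⟪ (λ b → ⟪ δ c , F · basis b ⟫) , v ⟫            ≡⟨ pairing-congˡ (agree c) v ⟩
    ⟪ (λ b → ⟪ δ c , G · basis b ⟫) , v ⟫            ≡⟨ pairing-· G (δ c) v ⟨
    ⟪ δ c , G · v ⟫                                  ≡⟨ coeff-pairing (G · v) c ⟨
    coeff (G · v) c                                  ∎
    where
    δ : B → B → ℚ
    δ c b = coeff (basis b) c
    agree : ∀ c b → ⟪ δ c , F · basis b ⟫ ≡ ⟪ δ c , G · basis b ⟫
    agree c b = trans (sym (coeff-pairing (F · basis b) c))
                      (trans (F≈G c b) (coeff-pairing (G · basis b) c))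

  pairing-mapMaybe : ∀ {A : Set} {n} g (p : A → ℚ × B) {C : Set} (f : C → Maybe A) (t : Fin n → C) →
    ⟪ g , map p (mapMaybe f (tabulate t)) ⟫ ≡
    sum (λ i → maybe (λ x → proj₁ (p x) * g (proj₂ (p x))) 0ℚ (f (t i)))
  pairing-mapMaybe {n = zero}  g p f t = refl
  pairing-mapMaybe {n = suc n} g p f t with f (t zero)
  ... | just x  = cong (_+_ (proj₁ (p x) * g (proj₂ (p x)))) (pairing-mapMaybe g p f (t ∘ suc))
  ... | nothing = trans (pairing-mapMaybe g p f (t ∘ suc)) (sym (+-identityˡ _))

open import Defs

-- Integers as rationals, and contents.

cast : ℕ → ℚ
cast m = + m / 1

-- Computes to the scalar `+ 2 / 1` of the bracket relations.
2ℚ : ℚ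
2ℚ = 1ℚ + 1ℚ

cast-suc : ∀ m → cast (suc m) ≡ 1ℚ + cast m
cast-suc m = /1-homo-+ (+ 1) (+ m)

cast-double : ∀ m → cast (2 ℕ.* m) ≡ 2ℚ * cast m
cast-double m = begin
  cast (m ℕ.+ (m ℕ.+ 0))  ≡⟨ cong (λ k → cast (m ℕ.+ k)) (ℕₚ.+-identityʳ m) ⟩
  cast (m ℕ.+ m)          ≡⟨ /1-homo-+ (+ m) (+ m) ⟩
  cast m + cast m         ≡⟨ solve 1 (λ x → x :+ x := con 2ℚ :* x) refl (cast m) ⟩
  2ℚ * cast m      ∎

content-cast : ∀ i j → content (i , j) / 1 ≡ cast j - cast i
content-cast i j = trans (/1-homo-+ (+ j) (ℤ.- + i)) (cong (_+_ (cast j)) (neg i))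
  where
  neg : ∀ i → (ℤ.- + i) / 1 ≡ - cast i
  neg zero    = refl
  neg (suc i) = refl

-- Adding and removing cells of row vectors.

infixl 8 _↑_ _↓_
infix 5 _when_

Young : ∀ {n} → Vec ℕ n → Set
Young = Linked _≥_

-- Total, whether or not the result is a diagram: the conditions go into the weights instead.
_↑_ _↓_ : ∀ {n} → Vec ℕ n → Fin n → Vec ℕ n
v ↑ i = updateAt v i suc
v ↓ i = updateAt v i pred

young? : ∀ {n} (v : Vec ℕ n) → Dec (Young v)
young? = Linked.linked? ℕₚ._≥?_

addable? : ∀ {n} (v : Vec ℕ n) i → Dec (Young (v ↑ i))
addable? v i = young? (v ↑ i)

-- Positivity is asked for separately because `pred` fixes 0: on an empty row `↓` returns the vector
-- itself.
removable? : ∀ {n} (v : Vec ℕ n) i → Dec (0 < lookup v i × Young (v ↓ i))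
removable? v i = 0 ℕₚ.<? lookup v i ×-dec young? (v ↓ i)

_when_ : {P : Set} → ℚ → Dec P → ℚ
x when p = if does p then x else 0ℚ

when-yes : ∀ {P : Set} x (p : Dec P) → P → x when p ≡ x
when-yes x p holds rewrite dec-true p holds = refl

when-no : ∀ {P : Set} x (p : Dec P) → ¬ P → x when p ≡ 0ℚ
when-no x p fails rewrite dec-false p fails = refl

when-cong : ∀ {P Q : Set} x (p : Dec P) (q : Dec Q) → (P → Q) → (Q → P) → x when p ≡ x when q
when-cong x p q P⇒Q Q⇒P rewrite does-⇔ (mk⇔ P⇒Q Q⇒P) p q = refl

↓-≔ : ∀ {n} (v : Vec ℕ n) i {j} → lookup v i ≡ suc j → v [ i ]≔ j ≡ v ↓ i
↓-≔ v i eq = updateAt-cong-local i v (sym (cong pred eq))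

↓-↑ : ∀ {n} (v : Vec ℕ n) i → 0 < lookup v i → v ↓ i ↑ i ≡ v
↓-↑ v i 0<vᵢ = trans
  (updateAt-updateAt-local i v (ℕₚ.suc-pred (lookup v i) {{ℕ.>-nonZero 0<vᵢ}}))
  (updateAt-id i v)

↑-↓ : ∀ {n} (v : Vec ℕ n) i → v ↑ i ↓ i ≡ v
↑-↓ v i = trans (updateAt-updateAt i v) (updateAt-id i v)

sum-↑ : ∀ {n} (v : Vec ℕ n) i → Vec.sum (v ↑ i) ≡ suc (Vec.sum v)
sum-↑ (x ∷ v) zero    = refl
sum-↑ (x ∷ v) (suc i) = trans (cong (x ℕ.+_) (sum-↑ v i)) (ℕₚ.+-suc x _)

-- Meets and joins of diagrams.

module _ {A : Set} {_∙_ : A → A → A} (idem : ∀ x → x ∙ x ≡ x) where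

  zipWith-updateAt : ∀ {f g} → (∀ x → x ∙ f x ≡ g x) →
    ∀ {n} (v : Vec A n) i → zipWith _∙_ v (updateAt v i f) ≡ updateAt v i g
  zipWith-updateAt f⇒g (x ∷ v) zero    = cong₂ _∷_ (f⇒g x) (zipWith-idem idem v)
  zipWith-updateAt f⇒g (x ∷ v) (suc i) = cong₂ _∷_ (idem x) (zipWith-updateAt f⇒g v i)

  -- Idempotence settles the rows other than `i` and `k`. Leaving `g` and `g′` free covers both
  -- operations: of `pred` and `suc`, `⊓` keeps the first and `⊔` the second, the other becoming
  -- `id`.
  zipWith-updateAt₂ : ∀ {f f′ g g′} → (∀ x → x ∙ f x ≡ g x) → (∀ x → x ∙ f′ x ≡ g′ x) →
    ∀ {n} (v : Vec A n) i k → i ≢ k →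
    zipWith _∙_ v (updateAt (updateAt v i f) k f′) ≡ updateAt (updateAt v i g) k g′
  zipWith-updateAt₂ p q (x ∷ v) zero    zero    i≢k = contradiction refl i≢k
  zipWith-updateAt₂ p q (x ∷ v) zero    (suc k) i≢k = cong₂ _∷_ (p x) (zipWith-updateAt q v k)
  zipWith-updateAt₂ p q (x ∷ v) (suc i) zero    i≢k = cong₂ _∷_ (q x) (zipWith-updateAt p v i)
  zipWith-updateAt₂ p q (x ∷ v) (suc i) (suc k) i≢k =
    cong₂ _∷_ (idem x) (zipWith-updateAt₂ p q v i k (i≢k ∘ cong suc))

young-zipWith : ∀ {_∙_ : ℕ → ℕ → ℕ} → (∀ {a b c d} → a ≤ b → c ≤ d → (a ∙ c) ≤ (b ∙ d)) →
  ∀ {n} {u v : Vec ℕ n} → Young u → Young v → Young (zipWith _∙_ u v)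
young-zipWith mono []      []      = []
young-zipWith mono [-]     [-]     = [-]
young-zipWith mono {u = _ ∷ _ ∷ _} {_ ∷ _ ∷ _} (p ∷ ps) (q ∷ qs) = mono p q ∷ young-zipWith mono ps qs

-- v - eᵢ is the meet, and v + eₖ the join, of v and v - eᵢ + eₖ.

young-↓ : ∀ {n} (v : Vec ℕ n) i k → i ≢ k → Young v → Young (v ↓ i ↑ k) → Young (v ↓ i)
young-↓ v i k i≢k v-young young = subst Young
  (trans (zipWith-updateAt₂ ℕₚ.⊓-idem (λ _ → ℕₚ.m≥n⇒m⊓n≡n ℕₚ.pred[n]≤n)
           (λ x → ℕₚ.m≤n⇒m⊓n≡m (ℕₚ.n≤1+n x)) v i k i≢k)
         (updateAt-id k (v ↓ i)))
  (young-zipWith ℕₚ.⊓-mono-≤ v-young young)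

young-↑ : ∀ {n} (v : Vec ℕ n) i k → i ≢ k → Young v → Young (v ↓ i ↑ k) → Young (v ↑ k)
young-↑ v i k i≢k v-young young = subst Young
  (trans (zipWith-updateAt₂ ℕₚ.⊔-idem (λ _ → ℕₚ.m≥n⇒m⊔n≡m ℕₚ.pred[n]≤n)
           (λ x → ℕₚ.m≤n⇒m⊔n≡n (ℕₚ.n≤1+n x)) v i k i≢k)
         (cong (_↑ k) (updateAt-id i v)))
  (young-zipWith ℕₚ.⊔-mono-≤ v-young young)

-- Sums over the corners of a diagram.

-- For consecutive rows x < m, a cell can be removed from the upper and added to the
-- lower one. If x = m both are impossible, and their values would cancel.
corners : ∀ {n} (φ : ℕ → ℕ → ℚ) m (v : Vec ℕ n) → Young (m ∷ v) → φ (suc n) 0 ≡ 0ℚ →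
  sum (λ i → φ (suc (toℕ i)) (lookup (m ∷ v) i) when removable? (m ∷ v) i)
    + sum (λ i → φ (suc (toℕ i)) (lookup v i)) ≡
  sum (λ i → φ (suc (toℕ i)) (lookup v i) when addable? (m ∷ v) (suc i))
    + sum (λ i → φ (suc (toℕ i)) (lookup (m ∷ v) i))
-- The last row is empty: nothing can be removed, and the boundary hypothesis, here `φ 1 0 ≡ 0ℚ`,
-- makes its value in the full sum vanish.
corners φ zero    [] _ φ≡0 = sym (cong (λ x → 0ℚ + (x + 0ℚ)) φ≡0)
corners φ (suc m) [] _ φ≡0 = +-comm (φ 1 (suc m) + 0ℚ) 0ℚ
corners {suc n} φ m v@(x ∷ s) (x≤m ∷ v-young) φ≡0 = begin
  (R₀ + sum R) + (φ 1 x + sum P)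
    ≡⟨ cong (λ y → (R₀ + y) + (φ 1 x + sum P)) (sum-cong-≗ R-tail) ⟩
  (R₀ + sum R′) + (φ 1 x + sum P)
    ≡⟨ solve 4 (λ a b c d → (a :+ b) :+ (c :+ d) := (a :+ c) :+ (b :+ d)) refl R₀ (sum R′) (φ 1 x) (sum P) ⟩
  (R₀ + φ 1 x) + (sum R′ + sum P)
    -- `gap` treats the two top rows; the induction starts at row `x`, with `φ ∘ suc` keeping the
    -- original row numbers.
    ≡⟨ cong₂ _+_ gap (corners (φ ∘ suc) x s v-young φ≡0) ⟩
  (A₀ + φ 1 m) + (sum A′ + sum Q)
    ≡⟨ solve 4 (λ a b c d → (a :+ b) :+ (c :+ d) := (a :+ c) :+ (b :+ d)) refl A₀ (φ 1 m) (sum A′) (sum Q) ⟩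
  (A₀ + sum A′) + (φ 1 m + sum Q)
    ≡⟨ cong (λ y → (A₀ + y) + (φ 1 m + sum Q)) (sum-cong-≗ A-tail) ⟨
  (A₀ + sum A) + (φ 1 m + sum Q)
    ∎
  where
  R₀ A₀ : ℚ
  R₀ = φ 1 m when removable? (m ∷ v) zero
  A₀ = φ 1 x when addable? (m ∷ v) (suc zero)
  R R′ Q : Fin (suc n) → ℚ
  R  i = φ (2 ℕ.+ toℕ i) (lookup v i) when removable? (m ∷ v) (suc i)
  R′ i = φ (2 ℕ.+ toℕ i) (lookup v i) when removable? v i
  Q  i = φ (2 ℕ.+ toℕ i) (lookup v i)
  A A′ P : Fin n → ℚ
  A  i = φ (2 ℕ.+ toℕ i) (lookup s i) when addable? (m ∷ v) (suc (suc i))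
  A′ i = φ (2 ℕ.+ toℕ i) (lookup s i) when addable? v (suc i)
  P  i = φ (2 ℕ.+ toℕ i) (lookup s i)
  R-tail : ∀ i → R i ≡ R′ i
  R-tail i = when-cong _ (removable? (m ∷ v) (suc i)) (removable? v i)
    (λ (0<vᵢ , p) → 0<vᵢ , Linked.tail p) (λ (0<vᵢ , p) → 0<vᵢ , below i ∷ p)
    where
    below : ∀ i → Vec.head (v ↓ i) ≤ m
    below zero    = ℕₚ.≤-trans ℕₚ.pred[n]≤n x≤m
    below (suc i) = x≤m
  A-tail : ∀ i → A i ≡ A′ i
  A-tail i = when-cong _ (addable? (m ∷ v) (suc (suc i))) (addable? v (suc i)) Linked.tail (x≤m ∷_)
  removable⇒< : 0 < m × Young (pred m ∷ v) → x < m
  removable⇒< (s≤s _ , x≤m-1 ∷ _) = s≤s x≤m-1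
  <⇒removable : x < m → 0 < m × Young (pred m ∷ v)
  <⇒removable (s≤s x≤m-1) = s≤s z≤n , x≤m-1 ∷ v-young
  <⇒addable : ∀ {s : Vec ℕ n} → Young (x ∷ s) → x < m → Young (m ∷ suc x ∷ s)
  <⇒addable [-]     x<m = x<m ∷ [-]
  <⇒addable (p ∷ q) x<m = x<m ∷ ℕₚ.m≤n⇒m≤1+n p ∷ q
  gap : R₀ + φ 1 x ≡ A₀ + φ 1 m
  gap with x ℕₚ.<? m
  ... | yes x<m = trans
    (cong₂ _+_ (when-yes (φ 1 m) (removable? (m ∷ v) zero) (<⇒removable x<m)) refl)
    (trans (+-comm (φ 1 m) (φ 1 x))
      (cong₂ _+_ (sym (when-yes (φ 1 x) (addable? (m ∷ v) (suc zero)) (<⇒addable v-young x<m))) refl))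
  ... | no x≮m = cong₂ _+_
    (trans (when-no (φ 1 m) (removable? (m ∷ v) zero) (x≮m ∘ removable⇒<))
      (sym (when-no (φ 1 x) (addable? (m ∷ v) (suc zero)) (x≮m ∘ Linked.head))))
    (cong (φ 1) (ℕₚ.≤-antisym x≤m (ℕₚ.≮⇒≥ x≮m)))

young-↑-zero : ∀ {n} {m} {v : Vec ℕ n} → Young (m ∷ v) → Young (suc m ∷ v)
young-↑-zero [-]     = [-]
young-↑-zero (p ∷ q) = ℕₚ.m≤n⇒m≤1+n p ∷ q

sum-neg : ∀ {n} (f : Fin n → ℚ) → sum (λ i → - f i) ≡ - sum f
sum-neg {zero}  f = refl
sum-neg {suc n} f = trans (cong (_+_ (- f zero)) (sum-neg (f ∘ suc))) (sym (neg-distrib-+ (f zero) _))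

sum-minus : ∀ {n} (f g : Fin n → ℚ) → sum (λ i → f i - g i) ≡ sum f - sum g
sum-minus f g = trans (∑-distrib-+ f (λ i → - g i)) (cong (_+_ (sum f)) (sum-neg g))

-- `corners` matches the removal from a row with the addition to the next one; the addition to the
-- top row has no partner, but it is always possible.
all-corners : ∀ {n} (φ : ℕ → ℕ → ℚ) (v : Vec ℕ n) → Young v → φ n 0 ≡ 0ℚ →
  sum (λ i → φ (suc (toℕ i)) (lookup v i) when removable? v i)
    - sum (λ i → φ (toℕ i) (lookup v i) when addable? v i) ≡
  sum (λ i → φ (suc (toℕ i)) (lookup v i)) - sum (λ i → φ (toℕ i) (lookup v i))
all-corners φ [] _ _ = refl
all-corners {suc n} φ (m ∷ v) v-young φ≡0 = begin
  sum R - ((φ 0 m when addable? (m ∷ v) zero) + sum A)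
    ≡⟨ cong (λ x → sum R - (x + sum A))
         (when-yes (φ 0 m) (addable? (m ∷ v) zero) (young-↑-zero v-young)) ⟩
  sum R - (φ 0 m + sum A)
    -- `sum P` is added and subtracted to produce the left side of `corners`.
    ≡⟨ solve 4 (λ r x a p → r :- (x :+ a) := (r :+ p) :- a :- (x :+ p)) refl (sum R) (φ 0 m) (sum A) (sum P) ⟩
  (sum R + sum P) - sum A - (φ 0 m + sum P)
    ≡⟨ cong (λ y → y - sum A - (φ 0 m + sum P)) (corners φ m v v-young φ≡0) ⟩
  (sum A + sum Q) - sum A - (φ 0 m + sum P)
    ≡⟨ solve 3 (λ a q s → (a :+ q) :- a :- s := q :- s) refl (sum A) (sum Q) (φ 0 m + sum P) ⟩
  sum Q - (φ 0 m + sum P)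
    ∎
  where
  R Q : Fin (suc n) → ℚ
  R i = φ (suc (toℕ i)) (lookup (m ∷ v) i) when removable? (m ∷ v) i
  Q i = φ (suc (toℕ i)) (lookup (m ∷ v) i)
  A P : Fin n → ℚ
  A i = φ (suc (toℕ i)) (lookup v i) when addable? (m ∷ v) (suc i)
  P i = φ (suc (toℕ i)) (lookup v i)

-- Finite sums and conditional weights.

sum-only : ∀ {n} (f : Fin n → ℚ) i → (∀ k → i ≢ k → f k ≡ 0ℚ) → sum f ≡ f i
sum-only {suc n} f i off = begin
  sum f                                  ≡⟨ sum-remove f ⟩
  f i + sum (λ k → f (Fin.punchIn i k))  ≡⟨ cong (_+_ (f i)) (sum-cong-≗ λ k → off _ (Finₚ.punchInᵢ≢i i k ∘ sym)) ⟩
  f i + sum {n} (λ _ → 0ℚ)               ≡⟨ cong (_+_ (f i)) (sum-replicate-zero n) ⟩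
  f i + 0ℚ                               ≡⟨ +-identityʳ (f i) ⟩
  f i                                    ∎

-- Twice the sum of the row numbers below `k` is `k (k - 1)`. The offset `t` varies in the
-- induction, since renumbering the rows after the first turns it into `t + 2ℚ`.
affine-sum : ∀ {k} t (v : Vec ℕ k) →
  sum (λ i → 2ℚ * (cast (lookup v i) - cast (toℕ i)) - t) ≡
  2ℚ * cast (Vec.sum v) - cast k * (t + cast k - 1ℚ)
affine-sum t [] = solve 1 (λ t → con 0ℚ := con 2ℚ :* con 0ℚ :- con 0ℚ :* (t :+ con 0ℚ :- con 1ℚ)) refl t
affine-sum {suc k} t (x ∷ v) = begin
  2ℚ * (cast x - 0ℚ) - t + sum (λ i → 2ℚ * (cast (lookup v i) - cast (suc (toℕ i))) - t)
    ≡⟨ cong (_+_ (2ℚ * (cast x - 0ℚ) - t)) (sum-cong-≗ λ i →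
         trans (cong (λ y → 2ℚ * (cast (lookup v i) - y) - t) (cast-suc (toℕ i)))
           (solve 3 (λ x i t → con 2ℚ :* (x :- (con 1ℚ :+ i)) :- t := con 2ℚ :* (x :- i) :- (t :+ con 2ℚ)) refl
             (cast (lookup v i)) (cast (toℕ i)) t)) ⟩
  2ℚ * (cast x - 0ℚ) - t + sum (λ i → 2ℚ * (cast (lookup v i) - cast (toℕ i)) - (t + 2ℚ))
    ≡⟨ cong (_+_ (2ℚ * (cast x - 0ℚ) - t)) (affine-sum (t + 2ℚ) v) ⟩
  2ℚ * (cast x - 0ℚ) - t + (2ℚ * cast (Vec.sum v) - cast k * (t + 2ℚ + cast k - 1ℚ))
    ≡⟨ solve 4 (λ x s k t →
         con 2ℚ :* (x :- con 0ℚ) :- t :+ (con 2ℚ :* s :- k :* (t :+ con 2ℚ :+ k :- con 1ℚ)) :=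
         con 2ℚ :* (x :+ s) :- (con 1ℚ :+ k) :* (t :+ (con 1ℚ :+ k) :- con 1ℚ)) refl
         (cast x) (cast (Vec.sum v)) (cast k) t ⟩
  2ℚ * (cast x + cast (Vec.sum v)) - (1ℚ + cast k) * (t + (1ℚ + cast k) - 1ℚ)
    ≡⟨ cong₂ (λ y z → 2ℚ * y - z * (t + z - 1ℚ)) (/1-homo-+ (+ x) (+ Vec.sum v)) (cast-suc k) ⟨
  2ℚ * cast (x ℕ.+ Vec.sum v) - cast (suc k) * (t + cast (suc k) - 1ℚ)
    ∎

when-*-cong : ∀ {P : Set} (p : Dec P) {w x y z} → (P → w * x ≡ y * z) → (w when p) * x ≡ (y when p) * z
when-*-cong (yes p) eq = eq p
when-*-cong (no _) {x = x} {z = z} eq = trans (*-zeroˡ x) (sym (*-zeroˡ z))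

when-* : ∀ {P Q : Set} x y (p : Dec P) (q : Dec Q) → (x when p) * (y when q) ≡ x * y when (p ×-dec q)
when-* x y p q with does p | does q
... | true  | true  = refl
... | true  | false = *-zeroʳ x
... | false | true  = *-zeroˡ y
... | false | false = refl

when-*-comm : ∀ {P Q P′ Q′ : Set} x y (p : Dec P) (q : Dec Q) (p′ : Dec P′) (q′ : Dec Q′) →
  (P × Q → P′ × Q′) → (P′ × Q′ → P × Q) →
  (x when p) * (y when q) ≡ (y when p′) * (x when q′)
when-*-comm x y p q p′ q′ PQ⇒P′Q′ P′Q′⇒PQ = begin
  (x when p) * (y when q)      ≡⟨ when-* x y p q ⟩
  x * y when (p ×-dec q)       ≡⟨ cong (_when (p ×-dec q)) (*-comm x y) ⟩
  y * x when (p ×-dec q)       ≡⟨ when-cong (y * x) (p ×-dec q) (p′ ×-dec q′) PQ⇒P′Q′ P′Q′⇒PQ ⟩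
  y * x when (p′ ×-dec q′)     ≡⟨ when-* y x p′ q′ ⟨
  (y when p′) * (x when q′)    ∎

-- The two cells are neighbours on one diagonal.
content-diagonal : ∀ i x → 0 < x → content (i , pred x) / 1 ≡ content (suc i , x) / 1
content-diagonal i (suc j) _ = begin
  content (i , j) / 1                  ≡⟨ content-cast i j ⟩
  cast j - cast i                      ≡⟨ solve 2 (λ i j → j :- i := (con 1ℚ :+ j) :- (con 1ℚ :+ i)) refl (cast i) (cast j) ⟩
  (1ℚ + cast j) - (1ℚ + cast i)        ≡⟨ cong₂ _-_ (cast-suc j) (cast-suc i) ⟨
  cast (suc j) - cast (suc i)          ≡⟨ content-cast (suc i) (suc j) ⟨
  content (suc i , suc j) / 1          ∎

-- The transposed operators and their commutators.

module _ {n : ℕ} where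

  -- Matrix entries of `D̂₊` and `D̂₋`, set to zero on moves that do not give a diagram. Columns are
  -- numbered from 0, so the last cell of a row sits in column `pred` of its length.
  up-weight down-weight : Vec ℕ n → Fin n → ℚ
  up-weight   v i = content (toℕ i , lookup v i) / 1 when addable? v i
  down-weight v i = - (cast n + content (toℕ i , pred (lookup v i)) / 1) when removable? v i

  up down degree : (Vec ℕ n → ℚ) → Vec ℕ n → ℚ
  up     h v = sum λ i → up-weight v i * h (v ↑ i)
  down   h v = sum λ i → down-weight v i * h (v ↓ i)
  degree h v = cast (2 ℕ.* Vec.sum v) * h v

  weights-commute : ∀ v i k → i ≢ k → Young v →
    down-weight v i * up-weight (v ↓ i) k ≡ up-weight v k * down-weight (v ↑ k) i
  weights-commute v i k i≢k v-young
    -- Neither move changes the length of the other row, so the contents agree and only the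
    -- conditions remain to be compared. The fourth one is `removable? (v ↑ k) i` with its row
    -- length rewritten.
    rewrite lookup∘updateAt′ k i {pred} (i≢k ∘ sym) v | lookup∘updateAt′ i k {suc} i≢k v =
    when-*-comm (- (cast n + content (toℕ i , pred (lookup v i)) / 1)) (content (toℕ k , lookup v k) / 1)
      (removable? v i) (addable? (v ↓ i) k) (addable? v k) (0 ℕₚ.<? lookup v i ×-dec young? (v ↑ k ↓ i))
      (λ ((0<vᵢ , _) , y) → young-↑ v i k i≢k v-young y , 0<vᵢ , subst Young ↓-↑-comm y)
      (λ (_ , 0<vᵢ , y) → let y′ = subst Young (sym ↓-↑-comm) y in
         (0<vᵢ , young-↓ v i k i≢k v-young y′) , y′)
    where
    ↓-↑-comm : v ↓ i ↑ k ≡ v ↑ k ↓ i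
    ↓-↑-comm = updateAt-commutes k i (i≢k ∘ sym) v

  -- The cell removed from row i of length x has the content of cell (suc i , x); so
  -- removing it and adding it back has this weight at suc i, adding one and removing
  -- it again has this weight at i.
  corner-weight : ℕ → ℕ → ℚ
  corner-weight i x = - (cast n + content (i , x) / 1) * (content (i , x) / 1)

  down-up-diagonal : ∀ (h : Vec ℕ n → ℚ) v i → Young v →
    down-weight v i * (up-weight (v ↓ i) i * h (v ↓ i ↑ i)) ≡
    (corner-weight (suc (toℕ i)) (lookup v i) when removable? v i) * h v
  down-up-diagonal h v i v-young = when-*-cong (removable? v i) λ (0<vᵢ , _) →
    trans (cong₂ (λ w u → - (cast n + content (toℕ i , pred (lookup v i)) / 1) * (w * h u))
                 (trans (when-yes _ (addable? (v ↓ i) i) (subst Young (sym (↓-↑ v i 0<vᵢ)) v-young))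
                        (cong (λ x → content (toℕ i , x) / 1) (lookup∘updateAt i v)))
                 (↓-↑ v i 0<vᵢ))
    (trans (cong (λ c → - (cast n + c) * (c * h v)) (content-diagonal (toℕ i) (lookup v i) 0<vᵢ))
           (sym (*-assoc (- (cast n + c)) c (h v))))
    where c = content (suc (toℕ i) , lookup v i) / 1

  up-down-diagonal : ∀ (h : Vec ℕ n → ℚ) v i → Young v →
    up-weight v i * (down-weight (v ↑ i) i * h (v ↑ i ↓ i)) ≡
    (corner-weight (toℕ i) (lookup v i) when addable? v i) * h v
  up-down-diagonal h v i v-young = when-*-cong (addable? v i) λ _ →
    trans (cong₂ (λ w u → c * (w * h u))
                 (trans (when-yes _ (removable? (v ↑ i) i)
                          (subst (0 <_) (sym (lookup∘updateAt i v)) (s≤s z≤n) ,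
                           subst Young (sym (↑-↓ v i)) v-young))
                        (cong (λ x → - (cast n + content (toℕ i , pred x) / 1)) (lookup∘updateAt i v)))
                 (↑-↓ v i))
    (solve 3 (λ n c x → c :* ((:- (n :+ c)) :* x) := (:- (n :+ c)) :* c :* x) refl (cast n) c (h v))
    where c = content (toℕ i , lookup v i) / 1

  -- The cell `(n , 0)` just below the last row has content `-n`, so the factor `n + c`, whose `n`
  -- comes from the multiple of `ξ₋`, vanishes.
  corner-weight-boundary : corner-weight n 0 ≡ 0ℚ
  corner-weight-boundary = trans (cong (λ c → - (cast n + c) * c) (content-cast n 0))
    (solve 1 (λ n → (:- (n :+ (con 0ℚ :- n))) :* (con 0ℚ :- n) := con 0ℚ) refl (cast n))

  -- The contents at `suc i` and `i` differ by one and `corner-weight` is quadratic in the content,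
  -- so the difference is affine.
  corner-weight-step : ∀ i x → corner-weight (suc i) x - corner-weight i x ≡
                       2ℚ * (cast x - cast i) - (1ℚ - cast n)
  corner-weight-step i x
    rewrite content-cast (suc i) x | content-cast i x | cast-suc i =
    solve 3 (λ n x i →
      (:- (n :+ (x :- (con 1ℚ :+ i)))) :* (x :- (con 1ℚ :+ i)) :- (:- (n :+ (x :- i))) :* (x :- i) :=
      con 2ℚ :* (x :- i) :- (con 1ℚ :- n)) refl (cast n) (cast x) (cast i)

  corner-weights-sum : ∀ v → Young v →
    sum (λ i → corner-weight (suc (toℕ i)) (lookup v i) when removable? v i)
      - sum (λ i → corner-weight (toℕ i) (lookup v i) when addable? v i) ≡
    cast (2 ℕ.* Vec.sum v)
  corner-weights-sum v v-young = begin
    sum (λ i → corner-weight (suc (toℕ i)) (lookup v i) when removable? v i)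
      - sum (λ i → corner-weight (toℕ i) (lookup v i) when addable? v i)
      ≡⟨ all-corners corner-weight v v-young corner-weight-boundary ⟩
    sum (λ i → corner-weight (suc (toℕ i)) (lookup v i)) - sum (λ i → corner-weight (toℕ i) (lookup v i))
      ≡⟨ sum-minus {n} _ _ ⟨
    sum (λ i → corner-weight (suc (toℕ i)) (lookup v i) - corner-weight (toℕ i) (lookup v i))
      ≡⟨ sum-cong-≗ {n} (λ i → corner-weight-step (toℕ i) (lookup v i)) ⟩
    sum (λ i → 2ℚ * (cast (lookup v i) - cast (toℕ i)) - (1ℚ - cast n))
      -- With this offset and `n` rows, the correction term has the factor `1 - n + n - 1`, which is
      -- zero.
      ≡⟨ affine-sum (1ℚ - cast n) v ⟩
    2ℚ * cast (Vec.sum v) - cast n * (1ℚ - cast n + cast n - 1ℚ)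
      ≡⟨ solve 2 (λ s n → con 2ℚ :* s :- n :* (con 1ℚ :- n :+ n :- con 1ℚ) := con 2ℚ :* s) refl
           (cast (Vec.sum v)) (cast n) ⟩
    2ℚ * cast (Vec.sum v)
      ≡⟨ cast-double (Vec.sum v) ⟨
    cast (2 ℕ.* Vec.sum v)
      ∎

  down-up-commutator : ∀ h v → Young v → down (up h) v - up (down h) v ≡ degree h v
  down-up-commutator h v v-young = begin
    down (up h) v - up (down h) v
      -- Both products become double sums; `∑-comm` makes the row of the removal the outer index in
      -- each.
      ≡⟨ cong₂ _-_ (sum-cong-≗ {n} λ i → *-distribˡ-sum {n} (down-weight v i) _)
                   (trans (sum-cong-≗ {n} λ k → *-distribˡ-sum {n} (up-weight v k) _) (∑-comm {n} {n} λ k i → U i k)) ⟩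
    sum (λ i → sum (D i)) - sum (λ i → sum (U i))
      ≡⟨ sum-minus {n} _ _ ⟨
    sum (λ i → sum (D i) - sum (U i))
      ≡⟨ sum-cong-≗ {n} (λ i → trans (sym (sum-minus (D i) (U i))) (sum-only _ i (off-diagonal i))) ⟩
    sum (λ i → D i i - U i i)
      ≡⟨ sum-cong-≗ {n} (λ i → cong₂ _-_ (down-up-diagonal h v i v-young) (up-down-diagonal h v i v-young)) ⟩
    sum (λ i → R i * h v - A i * h v)
      ≡⟨ sum-minus {n} _ _ ⟩
    sum (λ i → R i * h v) - sum (λ i → A i * h v)
      ≡⟨ cong₂ _-_ (*-distribʳ-sum (h v) R) (*-distribʳ-sum (h v) A) ⟨
    sum R * h v - sum A * h v
      ≡⟨ solve 3 (λ r a x → r :* x :- a :* x := (r :- a) :* x) refl (sum R) (sum A) (h v) ⟩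
    (sum R - sum A) * h v
      ≡⟨ cong (_* h v) (corner-weights-sum v v-young) ⟩
    degree h v
      ∎
    where
    D U : Fin n → Fin n → ℚ
    D i k = down-weight v i * (up-weight (v ↓ i) k * h (v ↓ i ↑ k))
    U i k = up-weight v k * (down-weight (v ↑ k) i * h (v ↑ k ↓ i))
    R A : Fin n → ℚ
    R i = corner-weight (suc (toℕ i)) (lookup v i) when removable? v i
    A i = corner-weight (toℕ i) (lookup v i) when addable? v i
    off-diagonal : ∀ i k → i ≢ k → D i k - U i k ≡ 0ℚ
    off-diagonal i k i≢k = trans (cong (_- U i k) D≡U) (+-inverseʳ (U i k))
      where
      D≡U : D i k ≡ U i k
      D≡U = begin
        D i k
          ≡⟨ *-assoc (down-weight v i) _ _ ⟨
        down-weight v i * up-weight (v ↓ i) k * h (v ↓ i ↑ k)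
          ≡⟨ cong₂ (λ w u → w * h u) (weights-commute v i k i≢k v-young)
                                     (updateAt-commutes k i (i≢k ∘ sym) v) ⟩
        up-weight v k * down-weight (v ↑ k) i * h (v ↑ k ↓ i)
          ≡⟨ *-assoc (up-weight v k) _ _ ⟩
        U i k
          ∎

  -- Moves that change the degree from `d₀` to `d₀ + e` have bracket `e` with it. The hypothesis
  -- carries the factor `w i` because `↓` does not lower the size at an empty row, where the weight
  -- is zero.
  weighted-shift : ∀ (w d f : Fin n → ℚ) d₀ e → (∀ i → w i * d i ≡ w i * (d₀ + e)) →
    sum (λ i → w i * (d i * f i)) - d₀ * sum (λ i → w i * f i) ≡ e * sum (λ i → w i * f i)
  weighted-shift w d f d₀ e shift = begin
    sum (λ i → w i * (d i * f i)) - d₀ * S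
      ≡⟨ cong (_- d₀ * S) (sum-cong-≗ {n} λ i → begin
           w i * (d i * f i)          ≡⟨ *-assoc (w i) (d i) (f i) ⟨
           w i * d i * f i            ≡⟨ cong (_* f i) (shift i) ⟩
           w i * (d₀ + e) * f i       ≡⟨ solve 3 (λ w c f → w :* c :* f := c :* (w :* f)) refl (w i) (d₀ + e) (f i) ⟩
           (d₀ + e) * (w i * f i)     ∎) ⟩
    sum (λ i → (d₀ + e) * (w i * f i)) - d₀ * S
      ≡⟨ cong (_- d₀ * S) (*-distribˡ-sum {n} (d₀ + e) (λ i → w i * f i)) ⟨
    (d₀ + e) * S - d₀ * S
      ≡⟨ solve 3 (λ d e s → (d :+ e) :* s :- d :* s := e :* s) refl d₀ e S ⟩
    e * S
      ∎
    where S = sum (λ i → w i * f i)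

  degree-suc : ∀ m → cast (2 ℕ.* suc m) ≡ cast (2 ℕ.* m) + 2ℚ
  degree-suc m = begin
    cast (2 ℕ.* suc m)       ≡⟨ cast-double (suc m) ⟩
    2ℚ * cast (suc m)        ≡⟨ cong (2ℚ *_) (cast-suc m) ⟩
    2ℚ * (1ℚ + cast m)       ≡⟨ solve 1 (λ m → con 2ℚ :* (con 1ℚ :+ m) := con 2ℚ :* m :+ con 2ℚ) refl (cast m) ⟩
    2ℚ * cast m + 2ℚ         ≡⟨ cong (_+ 2ℚ) (cast-double m) ⟨
    cast (2 ℕ.* m) + 2ℚ      ∎

  up-degree-commutator : ∀ h v → up (degree h) v - degree (up h) v ≡ 2ℚ * up h v
  up-degree-commutator h v = weighted-shift (up-weight v) (λ i → cast (2 ℕ.* Vec.sum (v ↑ i)))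
    (λ i → h (v ↑ i)) (cast (2 ℕ.* Vec.sum v)) 2ℚ λ i → cong (up-weight v i *_)
    (trans (cong (λ m → cast (2 ℕ.* m)) (sum-↑ v i)) (degree-suc (Vec.sum v)))

  down-degree-commutator : ∀ h v → down (degree h) v - degree (down h) v ≡ - 2ℚ * down h v
  down-degree-commutator h v = weighted-shift (down-weight v) (λ i → cast (2 ℕ.* Vec.sum (v ↓ i)))
    (λ i → h (v ↓ i)) (cast (2 ℕ.* Vec.sum v)) (- 2ℚ) λ i →
    -- On a removable row `v` is `v ↓ i ↑ i`, so the count for additions applies to `v ↓ i`.
    when-*-cong (removable? v i) λ (0<vᵢ , _) →
    cong (- (cast n + content (toℕ i , pred (lookup v i)) / 1) *_) (begin
      cast (2 ℕ.* Vec.sum (v ↓ i))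
        ≡⟨ solve 1 (λ x → x := (x :+ con 2ℚ) :+ con (- 2ℚ)) refl (cast (2 ℕ.* Vec.sum (v ↓ i))) ⟩
      cast (2 ℕ.* Vec.sum (v ↓ i)) + 2ℚ + - 2ℚ
        ≡⟨ cong (_+ - 2ℚ) (degree-suc (Vec.sum (v ↓ i))) ⟨
      cast (2 ℕ.* suc (Vec.sum (v ↓ i))) + - 2ℚ
        ≡⟨ cong (λ m → cast (2 ℕ.* m) + - 2ℚ) (trans (cong Vec.sum (sym (↓-↑ v i 0<vᵢ))) (sum-↑ (v ↓ i) i)) ⟨
      cast (2 ℕ.* Vec.sum v) + - 2ℚ
        ∎)

  -- Passing from operators on diagrams to their transposes.

  open FreeVectorSpace (_≟ʸ_ {n}) using (⟪_,_⟫; ⟪⟫-cong; coeff; extend-basis; FormalSum; _*ₗ_; -ᴹ_)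

  infix 4 _transposesTo_

  -- `F*` acts on functions of arbitrary vectors, so transposes compose without proofs of `Young`;
  -- only values at diagrams are constrained.
  _transposesTo_ : LinearOperator {n} → ((Vec ℕ n → ℚ) → Vec ℕ n → ℚ) → Set
  F transposesTo F* = ∀ h l → ⟪ h ∘ rows , F · basis l ⟫ ≡ F* h (rows l)

  transpose-⁅⁆ : ∀ F G {F* G*} → F transposesTo F* → G transposesTo G* →
    ⁅ F , G ⁆ transposesTo λ h v → G* (F* h) v - F* (G* h) v
  transpose-⁅⁆ F G {F*} {G*} F-F* G-G* h l = begin
    ⟪ h ∘ rows , F · G · basis l ++ -ᴹ (G · F · basis l) ⟫
      ≡⟨ pairing-++ _≟ʸ_ (h ∘ rows) (F · G · basis l) (-ᴹ (G · F · basis l)) ⟩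
    ⟪ h ∘ rows , F · G · basis l ⟫ + ⟪ h ∘ rows , -ᴹ (G · F · basis l) ⟫
      ≡⟨ cong₂ _+_ (composite F G F-F* G-G*)
           (trans (pairing-neg _≟ʸ_ (h ∘ rows) (G · F · basis l)) (cong -_ (composite G F G-G* F-F*))) ⟩
    G* (F* h) (rows l) - F* (G* h) (rows l)
      ∎
    where
    composite : ∀ F G {F* G*} → F transposesTo F* → G transposesTo G* →
                ⟪ h ∘ rows , F · G · basis l ⟫ ≡ G* (F* h) (rows l)
    -- `F` moves onto the functional first, leaving `G` to act on `basis l`; hence the reversed
    -- order.
    composite F G {F*} F-F* G-G* = trans (pairing-· _≟ʸ_ F (h ∘ rows) (G · basis l))
      (trans (pairing-congˡ _≟ʸ_ (F-F* h) (G · basis l)) (G-G* (F* h) l))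

  transpose-• : ∀ a F {F*} → F transposesTo F* → a • F transposesTo λ h v → a * F* h v
  transpose-• a F F-F* h l = trans (pairing-*ₗ _≟ʸ_ (h ∘ rows) a (F · basis l)) (cong (a *_) (F-F* h l))

  -- Coordinate functionals have the form `δ c ∘ rows`, so transposes determine the operator; basis
  -- vectors are diagrams, so comparing at `Young` vectors suffices.
  transpose-injective : ∀ F G {F* G*} → F transposesTo F* → G transposesTo G* →
    (∀ h v → Young v → F* h v ≡ G* h v) → F ≋ G
  transpose-injective F G F-F* G-G* F*≗G* = ≋-on-basis _≟ʸ_ F G λ c l → begin
    coeff (F · basis l) c              ≡⟨ coeff-pairing _≟ʸ_ (F · basis l) c ⟩
    ⟪ δ c ∘ rows , F · basis l ⟫       ≡⟨ F-F* (δ c) l ⟩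
    _                                  ≡⟨ F*≗G* (δ c) (rows l) (decreasing l) ⟩
    _                                  ≡⟨ G-G* (δ c) l ⟨
    ⟪ δ c ∘ rows , G · basis l ⟫       ≡⟨ coeff-pairing _≟ʸ_ (G · basis l) c ⟨
    coeff (G · basis l) c              ∎
    where
    δ : YoungDiagram n → Vec ℕ n → ℚ
    -- On `rows l` this reduces to `coeff (basis l) c`, because `_≟ʸ_` decides by comparing rows;
    -- `+ 0ℚ` is the empty tail of `basis l`.
    δ c v = (if does (Vecₚ.≡-dec ℕₚ._≟_ v (rows c)) then 1ℚ else 0ℚ) + 0ℚ

  weighted : (Cell → ℚ) → List (Cell × YoungDiagram n) → FormalSum
  weighted q = map λ (□ , μ) → q □ , μ

  pairing-additions : ∀ q h l → ⟪ h ∘ rows , weighted q (additions l) ⟫ ≡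
    sum (λ i → (q (toℕ i , lookup (rows l) i) when addable? (rows l) i) * h (rows l ↑ i))
  pairing-additions q h l = trans (pairing-mapMaybe _≟ʸ_ (h ∘ rows) _ (addCell l) id) (sum-cong-≗ {n} term)
    where
    term : ∀ i → maybe (λ (□ , μ) → q □ * h (rows μ)) 0ℚ (addCell l i) ≡
                 (q (toℕ i , lookup (rows l) i) when addable? (rows l) i) * h (rows l ↑ i)
    term i with addable? (rows l) i
    ... | yes _ = refl
    ... | no _  = sym (*-zeroˡ (h (rows l ↑ i)))

  pairing-removals : ∀ q h l → ⟪ h ∘ rows , weighted q (removals l) ⟫ ≡
    sum (λ i → (q (toℕ i , pred (lookup (rows l) i)) when removable? (rows l) i) * h (rows l ↓ i))
  pairing-removals q h l = trans (pairing-mapMaybe _≟ʸ_ (h ∘ rows) _ (removeCell l) id) (sum-cong-≗ {n} term)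
    where
    term : ∀ i → maybe (λ (□ , μ) → q □ * h (rows μ)) 0ℚ (removeCell l i) ≡
                 (q (toℕ i , pred (lookup (rows l) i)) when removable? (rows l) i) * h (rows l ↓ i)
    term i with lookup (rows l) i in eq
    ... | zero = sym (*-zeroˡ (h (rows l ↓ i)))
    -- `removeCell` overwrites the row by `j` where `↓` applies `pred`; the two vectors must be
    -- identified before the decision is split.
    ... | suc j rewrite ↓-≔ (rows l) i eq with young? (rows l ↓ i)
    ...   | yes _ = refl
    ...   | no _  = sym (*-zeroˡ (h (rows l ↓ i)))

  -- `ξ₋` and `∇₋` run over the same removals, so their combination in `D̂₋` is a single weighted
  -- sum.
  pairing-weighted-linear : ∀ g a q xs →
    - (a * ⟪ g , weighted (λ _ → 1ℚ) xs ⟫ + ⟪ g , weighted q xs ⟫) ≡ ⟪ g , weighted (λ □ → - (a + q □)) xs ⟫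
  pairing-weighted-linear g a q []             = solve 1 (λ a → :- (a :* con 0ℚ :+ con 0ℚ) := con 0ℚ) refl a
  pairing-weighted-linear g a q ((□ , μ) ∷ xs) = trans
    (solve 5 (λ a q x s t → :- (a :* (con 1ℚ :* x :+ s) :+ (q :* x :+ t)) :=
                            (:- (a :+ q)) :* x :+ (:- (a :* s :+ t))) refl
      a (q □) (g μ) ⟪ g , weighted (λ _ → 1ℚ) xs ⟫ ⟪ g , weighted q xs ⟫)
    (cong (_+_ (- (a + q □) * g μ)) (pairing-weighted-linear g a q xs))

  D̂₊-transpose : D̂₊ n transposesTo up
  D̂₊-transpose h l = trans (⟪⟫-cong (h ∘ rows) (extend-basis (λ l → ∇₊ n · basis l) l))
    (trans (⟪⟫-cong (h ∘ rows) (extend-basis (weighted (λ □ → content □ / 1) ∘ additions) l))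
      (pairing-additions (λ □ → content □ / 1) h l))

  D̂₀-transpose : D̂₀ n transposesTo degree
  D̂₀-transpose h l = trans (⟪⟫-cong (h ∘ rows) (extend-basis (λ l → cast (2 ℕ.* ∣ l ∣) *ₗ basis l) l))
    (trans (pairing-*ₗ _≟ʸ_ (h ∘ rows) (cast (2 ℕ.* ∣ l ∣)) (basis l))
      (cong (cast (2 ℕ.* ∣ l ∣) *_) (pairing-basis _≟ʸ_ (h ∘ rows) l)))

  D̂₋-transpose : D̂₋ n transposesTo down
  D̂₋-transpose h l = begin
    ⟪ g , D̂₋ n · basis l ⟫
      ≡⟨ ⟪⟫-cong g (extend-basis (λ l → -ᴹ (cast n *ₗ (ξ₋ n · basis l) ++ ∇₋ n · basis l)) l) ⟩
    ⟪ g , -ᴹ (cast n *ₗ (ξ₋ n · basis l) ++ ∇₋ n · basis l) ⟫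
      ≡⟨ pairing-neg _≟ʸ_ g (cast n *ₗ (ξ₋ n · basis l) ++ ∇₋ n · basis l) ⟩
    - ⟪ g , cast n *ₗ (ξ₋ n · basis l) ++ ∇₋ n · basis l ⟫
      ≡⟨ cong -_ (pairing-++ _≟ʸ_ g (cast n *ₗ (ξ₋ n · basis l)) (∇₋ n · basis l)) ⟩
    - (⟪ g , cast n *ₗ (ξ₋ n · basis l) ⟫ + ⟪ g , ∇₋ n · basis l ⟫)
      ≡⟨ cong₂ (λ x y → - (x + y))
           (trans (pairing-*ₗ _≟ʸ_ g (cast n) (ξ₋ n · basis l))
                  (cong (cast n *_) (⟪⟫-cong g (extend-basis (weighted (λ _ → 1ℚ) ∘ removals) l))))
           (⟪⟫-cong g (extend-basis (weighted (λ □ → content □ / 1) ∘ removals) l)) ⟩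
    - (cast n * ⟪ g , weighted (λ _ → 1ℚ) (removals l) ⟫ + ⟪ g , weighted (λ □ → content □ / 1) (removals l) ⟫)
      ≡⟨ pairing-weighted-linear g (cast n) (λ □ → content □ / 1) (removals l) ⟩
    ⟪ g , weighted (λ □ → - (cast n + content □ / 1)) (removals l) ⟫
      ≡⟨ pairing-removals (λ □ → - (cast n + content □ / 1)) h l ⟩
    down h (rows l)
      ∎
    where g = h ∘ rows

theorem7 : (n : ℕ) → 1 ≤ n →
    (⁅ D̂₊ n , D̂₋ n ⁆ ≋ D̂₀ n) ×
    (⁅ D̂₀ n , D̂₊ n ⁆ ≋ (+ 2 / 1) • D̂₊ n) ×
    (⁅ D̂₀ n , D̂₋ n ⁆ ≋ (- (+ 2 / 1)) • D̂₋ n)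
theorem7 n _ =
  transpose-injective ⁅ D̂₊ n , D̂₋ n ⁆ (D̂₀ n)
    (transpose-⁅⁆ (D̂₊ n) (D̂₋ n) D̂₊-transpose D̂₋-transpose) D̂₀-transpose
    down-up-commutator ,
  transpose-injective ⁅ D̂₀ n , D̂₊ n ⁆ ((+ 2 / 1) • D̂₊ n)
    (transpose-⁅⁆ (D̂₀ n) (D̂₊ n) D̂₀-transpose D̂₊-transpose) (transpose-• (+ 2 / 1) (D̂₊ n) D̂₊-transpose)
    (λ h v _ → up-degree-commutator h v) ,
  transpose-injective ⁅ D̂₀ n , D̂₋ n ⁆ ((- (+ 2 / 1)) • D̂₋ n)
    (transpose-⁅⁆ (D̂₀ n) (D̂₋ n) D̂₀-transpose D̂₋-transpose) (transpose-• (- (+ 2 / 1)) (D̂₋ n) D̂₋-transpose)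
    (λ h v _ → down-degree-commutator h v)
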